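{- Let $a,d,b,k\in\mathbb{P}$ with $\gcd(a,d)=1$, $b\geq 2$ and $a\geq k-1$, and let $$A=\left(a,\ ba+d,\ b^2a+\tfrac{b^2-1}{b-1}d,\ \dots,\ b^ka+\tfrac{b^k-1}{b-1}d\right).$$ Then $$F(A)=\left((b-1)a-b+d+S_{a-1}\right)a-d,\qquad g(A)=\sum_{r=1}^{a-1}S_r+\frac{(a-1)\big((b-1)a+d-1\big)}{2},$$ where $S_r=\sum_{i=1}^k x_i$ for $(x_1,\dots,x_k)$ the greedy presentation of $r$ (in particular $x_k=\lfloor (b-1)r/(b^k-1)\rfloor$).
   Context: $\mathbb{P}$ denotes the positive integers, $\mathbb{N}$ the nonnegative integers. $\langle A\rangle$ is the numerical semigroup of all $\mathbb{N}$-linear combinations of entries of $A$; $F(A)$ is the largest integer not in $\langle A\rangle$ and $g(A)$ is the number of positive integers not in $\langle A\rangle$. Let $B_i=\frac{b^i-1}{b-1}$. The greedy presentation of $r\in\mathbb{N}$ is the tuple $(x_1,\dots,x_k)\in\mathbb{N}^k$ with $\sum_i B_i x_i=r$ obtained by the greedy algorithm (take $x_k$ maximal, then $x_{k-1}$ maximal for the remainder, etc.); equivalently $x_k=\lfloor (b-1)r/(b^k-1)\rfloor$, $x_i\in\{0,\dots,b\}$ for $i\le k-1$, and if $2\le i\le k-1$ and $x_i=b$ then $x_1=\dots=x_{i-1}=0$. -}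

module Defs where

open import Data.Fin.Base using (toℕ)
open import Data.Integer.Base as ℤ using (ℤ; +_)
open import Data.List.Base as List using (List)
open import Data.List.Membership.Propositional using (_∈_)
open import Data.List.Relation.Unary.Unique.Propositional using (Unique)
open import Data.Nat.Base
open import Data.Nat.Divisibility using (_∣_; divides)
open import Data.Nat.DivMod using (m*[n/m]≡n; m≥n⇒m/n>0; m*n/m*o≡n/o; /-congʳ)
open import Data.Nat.Properties
open import Data.Product.Base using (∃; _×_)
open import Data.Vec.Base as Vec using (Vec; []; _∷ʳ_)
open import Data.Vec.Functional using (Vector)
open import Data.Vec.Properties using (last-∷ʳ)
open import Function.Bundles using (_⇔_)
open import Relation.Binary.PropositionalEquality
open import Relation.Nullary.Negation using (¬_)

open import Algebra.Properties.Semiring.Sum +-*-semiring using (sum-syntax)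

private
  variable
    n : ℕ

infix 4 _∈⟨_⟩ _∉⟨_⟩

-- Membership is a predicate on ℤ, since the largest integer outside the
-- semigroup is -1 when 1 is a generator.

_∈⟨_⟩ : ℤ → Vector ℕ n → Set
_∈⟨_⟩ {n} z A = ∃ λ (c : Vector ℕ n) → z ≡ + (∑[ i < n ] (c i * A i))

_∉⟨_⟩ : ℤ → Vector ℕ n → Set
z ∉⟨ A ⟩ = ¬ (z ∈⟨ A ⟩)

IsFrobenius : Vector ℕ n → ℤ → Set
IsFrobenius A f = f ∉⟨ A ⟩ × (∀ z → z ∉⟨ A ⟩ → z ℤ.≤ f)

-- The list enumerates without repetition the positive integers outside ⟨ A ⟩.

IsGenus : Vector ℕ n → ℕ → Set
IsGenus A g = ∃ λ (gaps : List ℕ) →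
  Unique gaps ×
  (∀ m → m ∈ gaps ⇔ (0 < m × + m ∉⟨ A ⟩)) ×
  List.length gaps ≡ g

module _ (b : ℕ) .{{b≥2 : NonTrivial b}} where

  b∸1≢0 : NonZero (b ∸ 1)
  b∸1≢0 = >-nonZero (m<n⇒0<n∸m (nonTrivial⇒n>1 b))

  private
    instance
      _ = b∸1≢0
      _ = nonTrivial⇒nonZero b

  -- The floor division is exact: see B-exact.

  B : ℕ → ℕ
  B i = (b ^ i ∸ 1) / (b ∸ 1)

  private
    b∸1∣bⁱ∸1 : ∀ i → b ∸ 1 ∣ b ^ i ∸ 1
    b∸1∣bⁱ∸1 zero    = divides 0 refl
    b∸1∣bⁱ∸1 (suc i) with b∸1∣bⁱ∸1 i
    ... | divides q eq = divides (b ^ i + q) (begin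
      b * b ^ i ∸ 1                         ≡⟨ cong (λ c → c * b ^ i ∸ 1) (suc-pred b) ⟨
      b ^ i + (b ∸ 1) * b ^ i ∸ 1           ≡⟨ cong (_∸ 1) (+-comm (b ^ i) _) ⟩
      (b ∸ 1) * b ^ i + b ^ i ∸ 1           ≡⟨ +-∸-assoc ((b ∸ 1) * b ^ i) (m^n>0 b i) ⟩
      (b ∸ 1) * b ^ i + (b ^ i ∸ 1)         ≡⟨ cong₂ _+_ (*-comm (b ∸ 1) (b ^ i)) eq ⟩
      b ^ i * (b ∸ 1) + q * (b ∸ 1)         ≡⟨ *-distribʳ-+ (b ∸ 1) (b ^ i) q ⟨
      (b ^ i + q) * (b ∸ 1)                 ∎)
      where open ≡-Reasoning

  B-exact : ∀ i → (b ∸ 1) * B i ≡ b ^ i ∸ 1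
  B-exact i = m*[n/m]≡n (b∸1∣bⁱ∸1 i)

  B≢0 : ∀ k → NonZero (B (suc k))
  B≢0 k = >-nonZero
    (m≥n⇒m/n>0 (∸-monoˡ-≤ 1 (m≤m*n b (b ^ k) {{m^n≢0 b k}})))

  -- (x₁ , … , x_k): the last entry is the largest x with x * B k ≤ r, and the
  -- others are the greedy presentation of the remainder.

  greedy : ∀ k → ℕ → Vec ℕ k
  greedy zero    r = []
  greedy (suc k) r = greedy k (r % B (suc k)) ∷ʳ (r / B (suc k))
    where instance _ = B≢0 k

  bᵏ∸1≢0 : ∀ k → NonZero (b ^ suc k ∸ 1)
  bᵏ∸1≢0 k = subst (λ m → NonZero m) (B-exact (suc k))
    (m*n≢0 (b ∸ 1) (B (suc k)) {{b∸1≢0}} {{B≢0 k}})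

  greedy-last : ∀ k r →
    Vec.last (greedy (suc k) r) ≡ _/_ ((b ∸ 1) * r) (b ^ suc k ∸ 1) {{bᵏ∸1≢0 k}}
  greedy-last k r = begin
    Vec.last (greedy (suc k) r)             ≡⟨ last-∷ʳ _ (greedy k (r % B (suc k))) ⟩
    r / B (suc k)                           ≡⟨ m*n/m*o≡n/o (b ∸ 1) r (B (suc k)) ⟨
    (b ∸ 1) * r / ((b ∸ 1) * B (suc k))     ≡⟨ /-congʳ (B-exact (suc k)) ⟩
    (b ∸ 1) * r / (b ^ suc k ∸ 1)           ∎
    where
    open ≡-Reasoning
    instance
      _ = B≢0 k
      _ = bᵏ∸1≢0 k
      _ = m*n≢0 (b ∸ 1) (B (suc k))

  S : ℕ → ℕ → ℕ
  S k r = Vec.sum (greedy k r)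

  generators : (a d k : ℕ) → Vector ℕ (suc k)
  generators a d k i = b ^ toℕ i * a + B (toℕ i) * d

module Submission where

open import Defs

-- Put D = (b - 1) a + d. Since b ^ i = 1 + (b - 1) B i, the i-th generator is
-- a + B i * D, so ⟨ A ⟩ consists of the numbers s * a + m * D such that m is a
-- sum of at most s of the coins B 1 , … , B k. The greedy presentation uses the
-- fewest coins: since B j + b B i = B (i + 1) + b B (j - 1), adding one coin to m
-- raises S m by at most 1. Conversely S m ≤ S (m + 1) + (b - 1), because b coins
-- B i pay for B (i + 1) - 1. Hence among the m ≡ r (mod a) the cheapest is the
-- one with 0 ≤ r < a, and the Apéry set of a is { S r * a + r * D : 0 ≤ r < a },
-- which increases with r. Its last element minus a is the Frobenius number. The
-- residue class of r * D has S r + ⌊ r * D / a ⌋ gaps, and the floors at r and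
-- a - r add up to D - 1.

-- Coins `B b i` and the number of coins in a greedy presentation.

module GreedyCoins where
  open import Data.Fin.Base using (Fin; zero; suc; toℕ)
  open import Data.Nat.Base
  open import Data.Nat.DivMod
  open import Data.Nat.Divisibility using (n∣m*n)
  open import Data.Nat.Properties
  open import Data.Product.Base using (∃₂; _×_; _,_)
  open import Algebra.Properties.Semiring.Sum +-*-semiring using (sum-syntax)
  open import Data.Nat.Tactic.RingSolver using (solve-∀)
  open import Data.Sum.Base using (_⊎_; inj₁; inj₂)
  open import Data.Vec.Base as Vec using (Vec; []; _∷_; _∷ʳ_; lookup)
  open import Data.Vec.Functional using (Vector)
  open import Function.Base using (_∘_)
  open import Relation.Binary.PropositionalEquality

  sum-∷ʳ : ∀ {n} (xs : Vec ℕ n) x → Vec.sum (xs ∷ʳ x) ≡ Vec.sum xs + x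
  sum-∷ʳ []       x = +-identityʳ x
  sum-∷ʳ (y ∷ xs) x = trans (cong (y +_) (sum-∷ʳ xs x)) (sym (+-assoc y _ x))

  ∑-lookup : ∀ {n} (xs : Vec ℕ n) → ∑[ i < n ] lookup xs i ≡ Vec.sum xs
  ∑-lookup []       = refl
  ∑-lookup (x ∷ xs) = cong (x +_) (∑-lookup xs)

  ∑-lookup-∷ʳ : ∀ {n} (xs : Vec ℕ n) x (f : ℕ → ℕ) →
    ∑[ i < suc n ] (lookup (xs ∷ʳ x) i * f (toℕ i)) ≡
    ∑[ i < n ] (lookup xs i * f (toℕ i)) + x * f n
  ∑-lookup-∷ʳ []       x f = +-identityʳ (x * f 0)
  ∑-lookup-∷ʳ (y ∷ xs) x f =
    trans (cong (y * f 0 +_) (∑-lookup-∷ʳ xs x (f ∘ suc))) (sym (+-assoc (y * f 0) _ _))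

  module _ (b : ℕ) .{{_ : NonTrivial b}} where
    private instance
      _ = nonTrivial⇒nonZero b

    B-zero : B b 0 ≡ 0
    B-zero = 0/n≡0 (b ∸ 1) {{b∸1≢0 b}}

    ^≡1+[b∸1]B : ∀ i → b ^ i ≡ suc ((b ∸ 1) * B b i)
    ^≡1+[b∸1]B i =
      trans (sym (suc-pred (b ^ i) {{m^n≢0 b i}})) (cong suc (sym (B-exact b i)))

    B-suc : ∀ i → B b (suc i) ≡ suc (b * B b i)
    B-suc i = *-cancelˡ-≡ _ _ (b ∸ 1) {{b∸1≢0 b}} (begin
      (b ∸ 1) * B b (suc i)                      ≡⟨ B-exact b (suc i) ⟩
      b * b ^ i ∸ 1                              ≡⟨ cong (λ x → b * x ∸ 1) (^≡1+[b∸1]B i) ⟩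
      b * suc ((b ∸ 1) * B b i) ∸ 1              ≡⟨ cong (λ c → c * suc ((b ∸ 1) * B b i) ∸ 1) (suc-pred b) ⟨
      pred (suc (b ∸ 1) * suc ((b ∸ 1) * B b i)) ≡⟨ cong pred (rearrange (b ∸ 1) (B b i)) ⟩
      (b ∸ 1) * suc (suc (b ∸ 1) * B b i)        ≡⟨ cong (λ c → (b ∸ 1) * suc (c * B b i)) (suc-pred b) ⟩
      (b ∸ 1) * suc (b * B b i)                  ∎)
      where
      open ≡-Reasoning
      rearrange : ∀ p x → suc p * suc (p * x) ≡ suc (p * suc (suc p * x))
      rearrange = solve-∀

    B-mono : ∀ {i j} → i ≤ j → B b i ≤ B b j
    B-mono {j = j} z≤n = subst (_≤ B b j) (sym B-zero) z≤n
    B-mono (s≤s {i} {j} i≤j) = begin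
      B b (suc i)     ≡⟨ B-suc i ⟩
      suc (b * B b i) ≤⟨ s≤s (*-monoʳ-≤ b (B-mono i≤j)) ⟩
      suc (b * B b j) ≡⟨ B-suc j ⟨
      B b (suc j)     ∎
      where open ≤-Reasoning

    S-< : ∀ k {r} → r < B b (suc k) → S b (suc k) r ≡ S b k r
    S-< k {r} r<β = begin
      S b (suc k) r                                      ≡⟨ sum-∷ʳ (greedy b k (r % β)) (r / β) ⟩
      S b k (r % β) + r / β                              ≡⟨ cong₂ (λ s q → S b k s + q) (m<n⇒m%n≡m r<β) (m<n⇒m/n≡0 r<β) ⟩
      S b k r + 0                                        ≡⟨ +-identityʳ (S b k r) ⟩
      S b k r                                            ∎
      where
      open ≡-Reasoning
      β = B b (suc k)
      instance _ = B≢0 b k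

    -- Here `r` may exceed the top coin: a multiple of `B b (suc k)` only shifts the quotient by `q`
    -- and keeps the remainder.
    S-*+ : ∀ k q r → S b (suc k) (q * B b (suc k) + r) ≡ q + S b (suc k) r
    S-*+ k q r = begin
      S b (suc k) (q * β + r)                     ≡⟨ sum-∷ʳ (greedy b k ((q * β + r) % β)) ((q * β + r) / β) ⟩
      S b k ((q * β + r) % β) + (q * β + r) / β   ≡⟨ cong₂ (λ s p → S b k s + p) mod-eq div-eq ⟩
      S b k (r % β) + (q + r / β)                 ≡⟨ +-comm (S b k (r % β)) _ ⟩
      q + r / β + S b k (r % β)                   ≡⟨ +-assoc q (r / β) _ ⟩
      q + (r / β + S b k (r % β))                 ≡⟨ cong (q +_) (+-comm (r / β) _) ⟩
      q + (S b k (r % β) + r / β)                 ≡⟨ cong (q +_) (sum-∷ʳ (greedy b k (r % β)) (r / β)) ⟨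
      q + S b (suc k) r                           ∎
      where
      open ≡-Reasoning
      β = B b (suc k)
      instance _ = B≢0 b k
      mod-eq : (q * β + r) % β ≡ r % β
      mod-eq = %-remove-+ˡ r (n∣m*n q {β})
      div-eq : (q * β + r) / β ≡ q + r / β
      div-eq = trans (+-distrib-/-∣ˡ r (n∣m*n q {β})) (cong (_+ r / β) (m*n/n≡m q β))

    S-top : ∀ {k} → 0 < k → ∀ q r → S b k (q * B b k + r) ≡ q + S b k r
    S-top {suc k} _ = S-*+ k

    S-zero : ∀ k → S b k 0 ≡ 0
    S-zero zero    = refl
    S-zero (suc k) = trans (S-< k (>-nonZero⁻¹ _ {{B≢0 b k}})) (S-zero k)

    euclid : ∀ k m → ∃₂ λ q r → r < B b (suc k) × m ≡ q * B b (suc k) + r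
    euclid k m = m / β , m % β , m%n<n m β , trans (m≡m%n+[m/n]*n m β) (+-comm (m % β) _)
      where
      β = B b (suc k)
      instance _ = B≢0 b k

    -- Split off the `q` top coins of `m`, leaving `r`. A further top coin only raises `q`. A
    -- smaller coin added to `r` either stays below the top coin, which is the induction on `k`, or
    -- carries into one top coin and a remainder `e`. In that case `S b k e ≤ S b k r` is needed,
    -- and it comes from `add-coins` one level down, by comparing two payments of the same amount.
    add-coin : ∀ {k j} → j ≤ k → ∀ m → S b k (m + B b j) ≤ suc (S b k m)
    add-coins : ∀ {k j} → j ≤ k → ∀ n m → S b k (m + n * B b j) ≤ n + S b k m

    add-coins {k} j≤k zero    m = ≤-reflexive (cong (S b k) (+-identityʳ m))
    add-coins {k} {j} j≤k (suc n) m = begin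
      S b k (m + (B b j + n * B b j)) ≡⟨ cong (S b k) (trans (cong (m +_) (+-comm (B b j) _)) (sym (+-assoc m _ _))) ⟩
      S b k (m + n * B b j + B b j)   ≤⟨ add-coin j≤k (m + n * B b j) ⟩
      suc (S b k (m + n * B b j))     ≤⟨ s≤s (add-coins j≤k n m) ⟩
      suc (n + S b k m)               ∎
      where open ≤-Reasoning

    -- The coin `B b 0` is worth 0; it belongs to the generator `a`.
    add-coin {k} {zero} _ m = m≤n⇒m≤1+n (≤-reflexive (cong (S b k) (trans (cong (m +_) B-zero) (+-identityʳ m))))
    add-coin {suc k} {suc j} j≤k m with m≤n⇒m<n∨m≡n j≤k
    ... | inj₂ refl = ≤-reflexive (begin
      S b (suc k) (m + B b (suc k))     ≡⟨ cong (S b (suc k)) (trans (+-comm m _) (cong (_+ m) (sym (*-identityˡ _)))) ⟩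
      S b (suc k) (1 * B b (suc k) + m) ≡⟨ S-*+ k 1 m ⟩
      suc (S b (suc k) m)               ∎)
      where open ≡-Reasoning
    ... | inj₁ (s≤s j<k) with q , r , r<β , refl ← euclid k m = begin
      S b (suc k) (q * β + r + B b (suc j))   ≡⟨ cong (S b (suc k)) (+-assoc (q * β) r _) ⟩
      S b (suc k) (q * β + (r + B b (suc j))) ≡⟨ S-*+ k q (r + B b (suc j)) ⟩
      q + S b (suc k) (r + B b (suc j))       ≤⟨ +-monoʳ-≤ q (small (<-≤-connex (r + B b (suc j)) β)) ⟩
      q + suc (S b k r)                       ≡⟨ +-suc q _ ⟩
      suc (q + S b k r)                       ≡⟨ cong (λ s → suc (q + s)) (S-< k r<β) ⟨
      suc (q + S b (suc k) r)                 ≡⟨ cong suc (S-*+ k q r) ⟨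
      suc (S b (suc k) (q * β + r))           ∎
      where
      open ≤-Reasoning
      β = B b (suc k)
      small : r + B b (suc j) < β ⊎ β ≤ r + B b (suc j) →
        S b (suc k) (r + B b (suc j)) ≤ suc (S b k r)
      small (inj₁ <β) = ≤-trans (≤-reflexive (S-< k <β)) (add-coin j<k r)
      small (inj₂ β≤) = begin
        S b (suc k) (r + B b (suc j)) ≡⟨ cong (S b (suc k)) carry ⟩
        S b (suc k) (1 * β + e)       ≡⟨ S-*+ k 1 e ⟩
        suc (S b (suc k) e)           ≡⟨ cong suc (S-< k e<β) ⟩
        suc (S b k e)                 ≤⟨ s≤s exchange ⟩
        suc (S b k r)                 ∎
        where
        e = r + B b (suc j) ∸ β
        carry : r + B b (suc j) ≡ 1 * β + e
        carry = trans (sym (m+[n∸m]≡n β≤)) (cong (_+ e) (sym (*-identityˡ β)))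
        e<β : e < β
        e<β = +-cancelˡ-< β e β (begin-strict
          β + e           ≡⟨ m+[n∸m]≡n β≤ ⟩
          r + B b (suc j) <⟨ +-monoˡ-< (B b (suc j)) r<β ⟩
          β + B b (suc j) ≤⟨ +-monoʳ-≤ β (B-mono j≤k) ⟩
          β + β           ∎)
        -- Expanding both coins of the carry equation by `B-suc` and removing 1 from each side
        -- leaves `b` coins against `b` coins.
        r+bB≡bB+e : r + b * B b j ≡ b * B b k + e
        r+bB≡bB+e = suc-injective (begin-equality
          suc (r + b * B b j)   ≡⟨ +-suc r _ ⟨
          r + suc (b * B b j)   ≡⟨ cong (r +_) (B-suc j) ⟨
          r + B b (suc j)       ≡⟨ m+[n∸m]≡n β≤ ⟨
          β + e                 ≡⟨ cong (_+ e) (B-suc k) ⟩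
          suc (b * B b k + e)   ∎)
        -- e and b coins B k have the same value as r and b coins B j.
        exchange : S b k e ≤ S b k r
        exchange = +-cancelˡ-≤ b _ _ (begin
          b + S b k e             ≡⟨ S-top (≤-trans (s≤s z≤n) j<k) b e ⟨
          S b k (b * B b k + e)   ≡⟨ cong (S b k) r+bB≡bB+e ⟨
          S b k (r + b * B b j)   ≤⟨ add-coins (<⇒≤ j<k) b r ⟩
          b + S b k r             ∎)

    -- Coins are added kind by kind with `add-coins`. At `m = 0` this says that no payment uses
    -- fewer coins than the greedy one.
    greedy-optimal : ∀ k n (c : Vector ℕ n) (j : Fin n → ℕ) → (∀ i → j i ≤ k) → ∀ m →
      S b k (m + ∑[ i < n ] (c i * B b (j i))) ≤ ∑[ i < n ] c i + S b k m
    greedy-optimal k zero    c j j≤k m = ≤-reflexive (cong (S b k) (+-identityʳ m))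
    greedy-optimal k (suc n) c j j≤k m = begin
      S b k (m + (x + y))                           ≡⟨ cong (S b k) (trans (cong (m +_) (+-comm x y)) (sym (+-assoc m y x))) ⟩
      S b k (m + y + x)                             ≤⟨ add-coins (j≤k zero) (c zero) (m + y) ⟩
      c zero + S b k (m + y)                        ≤⟨ +-monoʳ-≤ (c zero) (greedy-optimal k n (c ∘ suc) (j ∘ suc) (j≤k ∘ suc) m) ⟩
      c zero + (∑[ i < n ] c (suc i) + S b k m)     ≡⟨ +-assoc (c zero) _ _ ⟨
      c zero + ∑[ i < n ] c (suc i) + S b k m       ∎
      where
      open ≤-Reasoning
      x = c zero * B b (j zero)
      y = ∑[ i < n ] (c (suc i) * B b (j (suc i)))

    ∑-greedy : ∀ k r →
      ∑[ i < suc k ] (lookup (greedy b (suc k) r) i * B b (suc (toℕ i))) ≡ r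
    ∑-greedy k r = begin
      ∑[ i < suc k ] (lookup (greedy b (suc k) r) i * B b (suc (toℕ i)))
        ≡⟨ ∑-lookup-∷ʳ (greedy b k (r % β)) (r / β) (B b ∘ suc) ⟩
      ∑[ i < k ] (lookup (greedy b k (r % β)) i * B b (suc (toℕ i))) + r / β * β
        ≡⟨ cong (_+ r / β * β) (remainder k (m%n<n r β)) ⟩
      r % β + r / β * β ≡⟨ m≡m%n+[m/n]*n r β ⟨
      r                 ∎
      where
      open ≡-Reasoning
      β = B b (suc k)
      instance _ = B≢0 b k
      remainder : ∀ l {s} → s < B b (suc l) →
        ∑[ i < l ] (lookup (greedy b l s) i * B b (suc (toℕ i))) ≡ s
      remainder (suc l) _ = ∑-greedy l _
      -- With no coins left, the bound `s < B b 1 = 1` forces the remainder to be 0; this is why the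
      -- bound is carried along.
      remainder zero {s} s<B = sym (n<1⇒n≡0 (subst (s <_) B₁≡1 s<B))
        where
        B₁≡1 : B b 1 ≡ 1
        B₁≡1 = trans (B-suc 0) (cong suc (trans (cong (b *_) B-zero) (*-zeroʳ b)))

    -- The top coins are set aside again. The induction on `k` covers everything except the case
    -- where `suc r` equals the top coin: then `r = b * B b k` costs at most `b`, while `suc r`
    -- costs 1.
    S-drop : ∀ k m → suc (S b k m) ≤ S b k (suc m) + b
    S-drop zero    m = >-nonZero⁻¹ b
    S-drop (suc k) m with q , r , r<β , refl ← euclid k m = begin
      suc (S b (suc k) (q * β + r))   ≡⟨ cong suc (S-*+ k q r) ⟩
      suc (q + S b (suc k) r)         ≡⟨ cong (λ s → suc (q + s)) (S-< k r<β) ⟩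
      suc (q + S b k r)               ≡⟨ +-suc q _ ⟨
      q + suc (S b k r)               ≤⟨ +-monoʳ-≤ q (small (m≤n⇒m<n∨m≡n r<β)) ⟩
      q + (S b (suc k) (suc r) + b)   ≡⟨ +-assoc q _ b ⟨
      q + S b (suc k) (suc r) + b     ≡⟨ cong (_+ b) (S-*+ k q (suc r)) ⟨
      S b (suc k) (q * β + suc r) + b ≡⟨ cong (λ n → S b (suc k) n + b) (+-suc (q * β) r) ⟩
      S b (suc k) (suc (q * β + r)) + b ∎
      where
      open ≤-Reasoning
      β = B b (suc k)
      small : suc r < β ⊎ suc r ≡ β → suc (S b k r) ≤ S b (suc k) (suc r) + b
      small (inj₁ 1+r<β) = ≤-trans (S-drop k r) (≤-reflexive (cong (_+ b) (sym (S-< k 1+r<β))))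
      small (inj₂ 1+r≡β) = begin
        suc (S b k r)                     ≡⟨ cong (λ n → suc (S b k n)) (suc-injective (trans 1+r≡β (B-suc k))) ⟩
        suc (S b k (0 + b * B b k))       ≤⟨ s≤s (add-coins {k} ≤-refl b 0) ⟩
        suc (b + S b k 0)                 ≡⟨ cong (λ s → suc (b + s)) (S-zero k) ⟩
        suc (b + 0)                       ≡⟨ cong suc (+-identityʳ b) ⟩
        1 + b                             ≤⟨ +-monoˡ-≤ b (s≤s z≤n) ⟩
        1 + S b (suc k) 0 + b             ≡⟨ cong (_+ b) (S-*+ k 1 0) ⟨
        S b (suc k) (1 * β + 0) + b       ≡⟨ cong (λ n → S b (suc k) n + b) (trans (+-identityʳ (1 * β)) (*-identityˡ β)) ⟩
        S b (suc k) β + b                 ≡⟨ cong (λ n → S b (suc k) n + b) 1+r≡β ⟨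
        S b (suc k) (suc r) + b           ∎

    S-drop-by : ∀ k n m → S b k m ≤ S b k (m + n) + n * (b ∸ 1)
    S-drop-by k zero    m = ≤-reflexive (trans (cong (S b k) (sym (+-identityʳ m))) (sym (+-identityʳ _)))
    S-drop-by k (suc n) m = begin
      S b k m                                   ≤⟨ s≤s⁻¹ (≤-trans (S-drop k m) (≤-reflexive 1+[b∸1])) ⟩
      S b k (suc m) + (b ∸ 1)                   ≤⟨ +-monoˡ-≤ (b ∸ 1) (S-drop-by k n (suc m)) ⟩
      S b k (suc m + n) + n * (b ∸ 1) + (b ∸ 1) ≡⟨ cong (λ x → S b k x + n * (b ∸ 1) + (b ∸ 1)) (+-suc m n) ⟨
      S b k (m + suc n) + n * (b ∸ 1) + (b ∸ 1) ≡⟨ +-assoc (S b k (m + suc n)) _ _ ⟩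
      S b k (m + suc n) + (n * (b ∸ 1) + (b ∸ 1)) ≡⟨ cong (S b k (m + suc n) +_) (+-comm (n * (b ∸ 1)) _) ⟩
      S b k (m + suc n) + suc n * (b ∸ 1)       ∎
      where
      open ≤-Reasoning
      1+[b∸1] : S b k (suc m) + b ≡ suc (S b k (suc m) + (b ∸ 1))
      1+[b∸1] = trans (cong (S b k (suc m) +_) (sym (suc-pred b))) (+-suc _ (b ∸ 1))

module AperySet where
  open GreedyCoins
  open import Data.Fin.Base using (Fin; zero; suc; toℕ; opposite)
  open import Data.Fin.Permutation using (reverse)
  open import Data.Fin.Properties using (toℕ<n; opposite-prop)
  open import Data.Integer.Base using () renaming (+_ to pos)
  open import Data.Integer.Properties using (+-injective)
  open import Data.List.Base using (List; applyUpTo; concat; length)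
  open import Data.List.Membership.Propositional using (_∈_)
  open import Data.List.Membership.Propositional.Properties
  open import Data.List.Properties using (length-++; length-applyUpTo)
  import Data.List.Relation.Unary.All.Properties as All
  import Data.List.Relation.Unary.AllPairs.Properties as AllPairs
  open import Data.List.Relation.Unary.Unique.Propositional using (Unique)
  import Data.List.Relation.Unary.Unique.Propositional.Properties as Unique
  open import Data.Nat.Base
  open import Data.Nat.Coprimality using (Coprime; coprime-divisor; coprime-Bézout)
  open import Data.Nat.DivMod
  open import Data.Nat.Divisibility
  open import Data.Nat.GCD using (module Bézout)
  open import Data.Nat.Properties
  open import Data.Nat.Tactic.RingSolver using (solve-∀)
  open import Data.Product.Base using (∃; ∃₂; _×_; _,_)
  open import Data.Sum.Base using (inj₁; inj₂)
  open import Data.Vec.Base using (lookup)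
  open import Data.Vec.Functional using (Vector)
  open import Function.Base using (_∘_; case_of_)
  open import Function.Bundles using (_⇔_; mk⇔)
  open import Relation.Binary.PropositionalEquality
  open import Relation.Nullary.Negation using (contradiction)
  open import Algebra.Properties.Semiring.Sum +-*-semiring using (sum-syntax; sum-cong-≗; ∑-distrib-+; sum-permute)

  -- By Bézout `D` is invertible modulo `a`, and `r` is `n` times the inverse, reduced modulo `a`.
  coprime-residue : ∀ {a D} .{{_ : NonZero a}} → Coprime a D →
    ∀ n → ∃ λ r → r < a × r * D % a ≡ n % a
  coprime-residue {a} {D} coprime n = reduce (multiple (coprime-Bézout coprime))
    where
    open ≡-Reasoning
    -- The congruence of `t * D` and `n` modulo `a`, with multiples of `a` on both sides to stay in
    -- `ℕ`.
    multiple : Bézout.Identity 1 a D → ∃ λ t → ∃₂ λ x y → t * D + x * a ≡ n + y * a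
    multiple (Bézout.-+ x y eq) = n * y , 0 , n * x , (begin
      n * y * D + 0 * a  ≡⟨ assoc n y D a ⟩
      n * (y * D)        ≡⟨ cong (n *_) eq ⟨
      n * (1 + x * a)    ≡⟨ expand n x a ⟩
      n + n * x * a      ∎)
      where
      assoc : ∀ n y D a → n * y * D + 0 * a ≡ n * (y * D)
      assoc = solve-∀
      expand : ∀ n x a → n * (1 + x * a) ≡ n + n * x * a
      expand = solve-∀
    -- Here - y inverts D modulo a, and (a ∸ 1) * y stands for - y.
    multiple (Bézout.+- x y eq) = (a ∸ 1) * (n * y) , n * x , n * y * D , (begin
      (a ∸ 1) * (n * y) * D + n * x * a         ≡⟨ collect (a ∸ 1) n y D x a ⟩
      (a ∸ 1) * (n * y * D) + n * (x * a)       ≡⟨ cong (λ z → (a ∸ 1) * (n * y * D) + n * z) eq ⟨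
      (a ∸ 1) * (n * y * D) + n * (1 + y * D)   ≡⟨ expand (a ∸ 1) n y D ⟩
      n + n * y * D * (1 + (a ∸ 1))             ≡⟨ cong (λ z → n + n * y * D * z) (suc-pred a) ⟩
      n + n * y * D * a                         ∎)
      where
      collect : ∀ p n y D x a → p * (n * y) * D + n * x * a ≡ p * (n * y * D) + n * (x * a)
      collect = solve-∀
      expand : ∀ p n y D → p * (n * y * D) + n * (1 + y * D) ≡ n + n * y * D * (1 + p)
      expand = solve-∀
    reduce : (∃ λ t → ∃₂ λ x y → t * D + x * a ≡ n + y * a) → ∃ λ r → r < a × r * D % a ≡ n % a
    reduce (t , x , y , eq) = t % a , m%n<n t a , (begin
      t % a * D % a                         ≡⟨ [m+kn]%n≡m%n _ (t / a * D + x) a ⟨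
      (t % a * D + (t / a * D + x) * a) % a ≡⟨ cong (_% a) (distrib (t % a) (t / a) D x a) ⟩
      ((t % a + t / a * a) * D + x * a) % a ≡⟨ cong (λ z → (z * D + x * a) % a) (m≡m%n+[m/n]*n t a) ⟨
      (t * D + x * a) % a                   ≡⟨ cong (_% a) eq ⟩
      (n + y * a) % a                       ≡⟨ [m+kn]%n≡m%n n y a ⟩
      n % a                                 ∎)
      where
      distrib : ∀ u v D x a → u * D + (v * D + x) * a ≡ (u + v * a) * D + x * a
      distrib = solve-∀

  length-concat-applyUpTo : ∀ {A : Set} (f : ℕ → List A) n →
    length (concat (applyUpTo f n)) ≡ ∑[ i < n ] length (f (toℕ i))
  length-concat-applyUpTo f zero    = refl
  length-concat-applyUpTo f (suc n) =
    trans (length-++ (f 0)) (cong (length (f 0) +_) (length-concat-applyUpTo (f ∘ suc) n))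

  -- Gauss's trick: reversal permutes the summands, so the doubled sum pairs `f i` with
  -- `f (opposite i)`.
  2*∑ : ∀ {n c} (f : Vector ℕ n) → (∀ i → f i + f (opposite i) ≡ c) →
    2 * ∑[ i < n ] f i ≡ n * c
  2*∑ {n} {c} f f+f≡c = begin
    2 * ∑[ i < n ] f i                              ≡⟨ cong (∑[ i < n ] f i +_) (+-identityʳ _) ⟩
    ∑[ i < n ] f i + ∑[ i < n ] f i                 ≡⟨ cong (∑[ i < n ] f i +_) (sum-permute f reverse) ⟩
    ∑[ i < n ] f i + ∑[ i < n ] f (opposite i)      ≡⟨ ∑-distrib-+ f (f ∘ opposite) ⟨
    ∑[ i < n ] (f i + f (opposite i))               ≡⟨ sum-cong-≗ f+f≡c ⟩
    ∑[ i < n ] c                                    ≡⟨ ∑-const n ⟩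
    n * c                                           ∎
    where
    open ≡-Reasoning
    ∑-const : ∀ n → ∑[ i < n ] c ≡ n * c
    ∑-const zero    = refl
    ∑-const (suc n) = cong (c +_) (∑-const n)

  module _ (q d b k : ℕ) .{{_ : NonZero d}} .{{_ : NonTrivial b}} where
    private
      a D : ℕ
      a = suc q
      D = (b ∸ 1) * a + d

    -- Semigroup elements as values `s * a + m * D`, and the Apéry set.

    coprime-D : Coprime a d → Coprime a D
    coprime-D coprime (i∣a , i∣D) =
      coprime (i∣a , ∣m+n∣m⇒∣n i∣D (∣n⇒∣m*n (b ∸ 1) i∣a))

    generator≡ : ∀ i → generators b a d k i ≡ a + B b (toℕ i) * D
    generator≡ i = begin
      b ^ toℕ i * a + β * d             ≡⟨ cong (λ p → p * a + β * d) (^≡1+[b∸1]B b (toℕ i)) ⟩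
      suc ((b ∸ 1) * β) * a + β * d     ≡⟨ rearrange (b ∸ 1) β a d ⟩
      a + β * D                         ∎
      where
      open ≡-Reasoning
      β = B b (toℕ i)
      rearrange : ∀ p β a d → suc (p * β) * a + β * d ≡ a + β * (p * a + d)
      rearrange = solve-∀

    value : ∀ {n} (c f : Fin n → ℕ) →
      ∑[ i < n ] (c i * (a + f i * D)) ≡ ∑[ i < n ] c i * a + ∑[ i < n ] (c i * f i) * D
    value {zero}  c f = refl
    value {suc n} c f = trans (cong (c zero * (a + f zero * D) +_) (value (c ∘ suc) (f ∘ suc)))
      (regroup (c zero) (f zero) a D (∑[ i < n ] c (suc i)) _)
      where
      regroup : ∀ x y a D s m → x * (a + y * D) + (s * a + m * D) ≡ (x + s) * a + (x * y + m) * D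
      regroup = solve-∀

    ∑-generators : (c : Vector ℕ (suc k)) →
      ∑[ i < suc k ] (c i * generators b a d k i) ≡
      ∑[ i < suc k ] c i * a + ∑[ i < suc k ] (c i * B b (toℕ i)) * D
    ∑-generators c =
      trans (sum-cong-≗ (λ i → cong (c i *_) (generator≡ i))) (value c (B b ∘ toℕ))

    -- `s` counts the generators used, with multiplicity, and `m` is the total worth of their coins.
    -- Copies of `a` count in `s` but add nothing to `m`.
    ∈⇒value : ∀ {n} → pos n ∈⟨ generators b a d k ⟩ →
      ∃₂ λ s m → S b k m ≤ s × n ≡ s * a + m * D
    ∈⇒value (c , eq) = _ , _ , optimal , trans (+-injective eq) (∑-generators c)
      where
      open ≤-Reasoning
      optimal : S b k (∑[ i < suc k ] (c i * B b (toℕ i))) ≤ ∑[ i < suc k ] c i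
      optimal = begin
        S b k (∑[ i < suc k ] (c i * B b (toℕ i))) ≤⟨ greedy-optimal b k (suc k) c toℕ (s≤s⁻¹ ∘ toℕ<n) 0 ⟩
        ∑[ i < suc k ] c i + S b k 0               ≡⟨ cong (∑[ i < suc k ] c i +_) (S-zero b k) ⟩
        ∑[ i < suc k ] c i + 0                     ≡⟨ +-identityʳ _ ⟩
        ∑[ i < suc k ] c i                         ∎

    -- The greedy presentation of `m` uses `S b k m` generators; those still missing from `s` are
    -- copies of `a`, which leave `m` unchanged.
    value⇒∈ : .{{_ : NonZero k}} → ∀ {s m} → S b k m ≤ s →
      pos (s * a + m * D) ∈⟨ generators b a d k ⟩
    value⇒∈ {s} {m} S≤s = c , cong pos (sym (trans (∑-generators c) (cong₂ (λ x y → x * a + y * D) count total)))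
      where
      open ≡-Reasoning
      c : Vector ℕ (suc k)
      c zero    = s ∸ S b k m
      c (suc i) = lookup (greedy b k m) i
      count : ∑[ i < suc k ] c i ≡ s
      count = trans (cong (s ∸ S b k m +_) (∑-lookup (greedy b k m))) (m∸n+n≡m S≤s)
      total : ∑[ i < suc k ] (c i * B b (toℕ i)) ≡ m
      total = begin
        (s ∸ S b k m) * B b 0 + ∑[ i < k ] (lookup (greedy b k m) i * B b (suc (toℕ i)))
          ≡⟨ cong₂ _+_ (trans (cong ((s ∸ S b k m) *_) (B-zero b)) (*-zeroʳ (s ∸ S b k m))) (sum-greedy k) ⟩
        m ∎
        where
        sum-greedy : ∀ k .{{_ : NonZero k}} → ∑[ i < k ] (lookup (greedy b k m) i * B b (suc (toℕ i))) ≡ m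
        sum-greedy (suc k) = ∑-greedy b k m

    -- Cancelling `D` modulo `a` shows that `a` divides the difference of `m` and `r`. If `m ≤ r`,
    -- this difference is also below `a`, hence 0.
    congruent : Coprime a D → ∀ {s m t r} → r < a → s * a + m * D ≡ t * a + r * D →
      ∃ λ j → m ≡ r + j * a
    congruent coprime {s} {m} {t} {r} r<a eq with ≤-total r m
    ... | inj₁ r≤m = case coprime-divisor coprime a∣D*e of λ where
        (divides j e≡ja) → j , trans (sym (m+[n∸m]≡n r≤m)) (cong (λ x → r + x) e≡ja)
      where
      open ≡-Reasoning
      e = m ∸ r
      regroup : ∀ s a r e D → s * a + (r + e) * D ≡ s * a + D * e + r * D
      regroup = solve-∀
      s*a+D*e≡t*a : s * a + D * e ≡ t * a
      s*a+D*e≡t*a = +-cancelʳ-≡ (r * D) _ _ (begin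
        s * a + D * e + r * D ≡⟨ regroup s a r e D ⟨
        s * a + (r + e) * D   ≡⟨ cong (λ x → s * a + x * D) (m+[n∸m]≡n r≤m) ⟩
        s * a + m * D         ≡⟨ eq ⟩
        t * a + r * D         ∎)
      a∣D*e : a ∣ D * e
      a∣D*e = ∣m+n∣m⇒∣n (divides t s*a+D*e≡t*a) (n∣m*n s)
    ... | inj₂ m≤r = 0 , (begin
      m                ≡⟨ +-identityʳ m ⟨
      m + 0            ≡⟨ cong (m +_) e≡0 ⟨
      m + e            ≡⟨ m+[n∸m]≡n m≤r ⟩
      r                ≡⟨ +-identityʳ r ⟨
      r + 0            ∎)
      where
      open ≡-Reasoning
      e = r ∸ m
      regroup : ∀ t a m e D → t * a + (m + e) * D ≡ t * a + D * e + m * D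
      regroup = solve-∀
      t*a+D*e≡s*a : t * a + D * e ≡ s * a
      t*a+D*e≡s*a = +-cancelʳ-≡ (m * D) _ _ (begin
        t * a + D * e + m * D ≡⟨ regroup t a m e D ⟨
        t * a + (m + e) * D   ≡⟨ cong (λ x → t * a + x * D) (m+[n∸m]≡n m≤r) ⟩
        t * a + r * D         ≡⟨ eq ⟨
        s * a + m * D         ∎)
      a∣e : a ∣ e
      a∣e = coprime-divisor coprime (∣m+n∣m⇒∣n (divides s t*a+D*e≡s*a) (n∣m*n t))
      e≡0 : e ≡ 0
      e≡0 with e | a∣e | ≤-<-trans (m∸n≤m r m) r<a
      ... | zero  | _   | _   = refl
      ... | suc _ | a∣1+ | 1+<a = contradiction (∣⇒≤ a∣1+) (<⇒≱ 1+<a)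

    -- With `m = r + j * a` the equation gives `t = s + j * D`. Passing from `m` down to `r` raises
    -- `S` by at most `j * a * (b ∸ 1) ≤ j * D`, which is covered by the growth from `s` to `t`. In
    -- other words, `t - S b k r` is at least `s - S b k m`: using `r` leaves the most spare copies
    -- of `a`.
    apery : Coprime a D → ∀ {s m t r} → r < a → s * a + m * D ≡ t * a + r * D →
      S b k r + s ≤ t + S b k m
    apery coprime {s} {m} {t} {r} r<a eq with j , refl ← congruent coprime {s} {m} {t} r<a eq = begin
      S b k r + s                                       ≤⟨ +-monoˡ-≤ s (S-drop-by b k (j * a) r) ⟩
      S b k (r + j * a) + j * a * (b ∸ 1) + s           ≤⟨ +-monoˡ-≤ s (+-monoʳ-≤ _ (≤-trans (≤-reflexive (regroup j a (b ∸ 1))) (*-monoʳ-≤ j (m≤m+n _ d)))) ⟩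
      S b k (r + j * a) + j * D + s                     ≡⟨ regroup′ _ (j * D) s ⟩
      s + j * D + S b k (r + j * a)                     ≡⟨ cong (_+ S b k (r + j * a)) s+j*D≡t ⟩
      t + S b k (r + j * a)                             ∎
      where
      open ≤-Reasoning
      regroup : ∀ j a p → j * a * p ≡ j * (p * a)
      regroup = solve-∀
      regroup′ : ∀ x y z → x + y + z ≡ z + y + x
      regroup′ = solve-∀
      collect : ∀ s j D a r → (s + j * D) * a + r * D ≡ s * a + (r + j * a) * D
      collect = solve-∀
      s+j*D≡t : s + j * D ≡ t
      s+j*D≡t = *-cancelʳ-≡ _ _ a (+-cancelʳ-≡ (r * D) _ _ (trans (collect s j D a r) eq))

    -- Each step in `r` gains `D ≥ (b ∸ 1) * a` and loses at most `(b ∸ 1) * a` through `S`.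
    apery-mono : ∀ {r r′} → r ≤ r′ → S b k r * a + r * D ≤ S b k r′ * a + r′ * D
    apery-mono {r} r≤r′ with n , refl ← m≤n⇒∃[o]m+o≡n r≤r′ = begin
      S b k r * a + r * D                                ≤⟨ +-monoˡ-≤ (r * D) (*-monoˡ-≤ a (S-drop-by b k n r)) ⟩
      (S b k (r + n) + n * (b ∸ 1)) * a + r * D          ≡⟨ regroup (S b k (r + n)) n (b ∸ 1) a (r * D) ⟩
      S b k (r + n) * a + (r * D + n * ((b ∸ 1) * a))    ≤⟨ +-monoʳ-≤ (S b k (r + n) * a) (+-monoʳ-≤ (r * D) (*-monoʳ-≤ n (m≤m+n _ d))) ⟩
      S b k (r + n) * a + (r * D + n * D)                ≡⟨ cong (S b k (r + n) * a +_) (*-distribʳ-+ D r n) ⟨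
      S b k (r + n) * a + (r + n) * D                    ∎
      where
      open ≤-Reasoning
      regroup : ∀ x n p a y → (x + n * p) * a + y ≡ x * a + (y + n * (p * a))
      regroup = solve-∀

    -- The Kunz coordinate for the class of `r * D`: the Apéry element `S b k r * a + r * D` equals
    -- `kunz r * a + r * D % a`. Classes are indexed by `r`, not by their residue.
    kunz : ℕ → ℕ
    kunz r = S b k r + r * D / a

    residue-eq : ∀ {n r} → r * D % a ≡ n % a → n + r * D / a * a ≡ n / a * a + r * D
    residue-eq {n} {r} eq = begin
      n + r * D / a * a                       ≡⟨ cong (_+ r * D / a * a) (m≡m%n+[m/n]*n n a) ⟩
      n % a + n / a * a + r * D / a * a       ≡⟨ cong (λ x → x + n / a * a + r * D / a * a) eq ⟨
      r * D % a + n / a * a + r * D / a * a   ≡⟨ regroup (r * D % a) (n / a * a) _ ⟩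
      n / a * a + (r * D % a + r * D / a * a) ≡⟨ cong (n / a * a +_) (m≡m%n+[m/n]*n (r * D) a) ⟨
      n / a * a + r * D                       ∎
      where
      open ≡-Reasoning
      regroup : ∀ x y z → x + y + z ≡ y + (x + z)
      regroup = solve-∀

    -- Write `n = s * a + m * D`. Adding `r * D / a` copies of `a` and using `residue-eq` gives two
    -- forms of one number, to which `apery` applies; then `S b k m ≤ s` lets `s` cancel.
    ∈⇒kunz≤ : Coprime a D → ∀ {n r} → r < a → r * D % a ≡ n % a →
      pos n ∈⟨ generators b a d k ⟩ → kunz r ≤ n / a
    ∈⇒kunz≤ coprime {n} {r} r<a eq n∈ = bound (∈⇒value n∈)
      where
      open ≤-Reasoning
      regroup : ∀ x y z → x + y + z ≡ x + (z + y)
      regroup = solve-∀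
      collect : ∀ s x a y → (s + x) * a + y ≡ s * a + y + x * a
      collect = solve-∀
      bound : (∃₂ λ s m → S b k m ≤ s × n ≡ s * a + m * D) → kunz r ≤ n / a
      bound (s , m , S≤s , n≡) = +-cancelʳ-≤ s _ _ (begin
        S b k r + r * D / a + s     ≡⟨ regroup (S b k r) _ s ⟩
        S b k r + (s + r * D / a)   ≤⟨ apery coprime {s + r * D / a} {m} {n / a} r<a eq′ ⟩
        n / a + S b k m             ≤⟨ +-monoʳ-≤ (n / a) S≤s ⟩
        n / a + s                   ∎)
        where
        eq′ : (s + r * D / a) * a + m * D ≡ n / a * a + r * D
        eq′ = trans (collect s (r * D / a) a (m * D))
          (trans (cong (_+ r * D / a * a) (sym n≡)) (residue-eq {n} {r} eq))

    -- `e` is the number of copies of `a` by which `n` exceeds the Apéry element of its class.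
    kunz+⇒value : ∀ {n r} e → r * D % a ≡ n % a →
      n / a ≡ kunz r + e → n ≡ (S b k r + e) * a + r * D
    kunz+⇒value {n} {r} e eq n/a≡ = +-cancelʳ-≡ (r * D / a * a) _ _ (begin
      n + r * D / a * a                             ≡⟨ residue-eq {n} {r} eq ⟩
      n / a * a + r * D                             ≡⟨ cong (λ x → x * a + r * D) n/a≡ ⟩
      (S b k r + r * D / a + e) * a + r * D         ≡⟨ regroup (S b k r) _ e a _ ⟩
      (S b k r + e) * a + r * D + r * D / a * a     ∎)
      where
      open ≡-Reasoning
      regroup : ∀ x y e a z → (x + y + e) * a + z ≡ (x + e) * a + z + y * a
      regroup = solve-∀

    kunz≤⇒∈ : .{{_ : NonZero k}} → ∀ {n r} → r * D % a ≡ n % a →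
      kunz r ≤ n / a → pos n ∈⟨ generators b a d k ⟩
    kunz≤⇒∈ {n} {r} eq k≤ with e , k+e≡ ← m≤n⇒∃[o]m+o≡n k≤ =
      subst (λ x → pos x ∈⟨ generators b a d k ⟩)
        (sym (kunz+⇒value {n} {r} e eq (sym k+e≡)))
        (value⇒∈ {S b k r + e} {r} (m≤m+n (S b k r) e))

    -- Enumeration of the gaps by residue class.

    row : ℕ → List ℕ
    row r = applyUpTo (λ j → r * D % a + j * a) (kunz r)

    -- The rows start at `r = 1`: the class of 0 has no gaps, since `kunz 0 = 0`.
    gaps : List ℕ
    gaps = concat (applyUpTo (row ∘ suc) q)

    row-% : ∀ {r n} → n ∈ row r → n % a ≡ r * D % a
    row-% {r} n∈ with j , _ , refl ← ∈-applyUpTo⁻ (λ j → r * D % a + j * a) n∈ =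
      trans ([m+kn]%n≡m%n (r * D % a) j a) (m%n%n≡m%n (r * D) a)

    row-/ : ∀ {r n} → n ∈ row r → n / a < kunz r
    row-/ {r} n∈ with j , j<k , refl ← ∈-applyUpTo⁻ (λ j → r * D % a + j * a) n∈ =
      subst (_< kunz r) (sym (begin
        (r * D % a + j * a) / a     ≡⟨ +-distrib-/-∣ʳ (r * D % a) (n∣m*n j {a}) ⟩
        r * D % a / a + j * a / a   ≡⟨ cong₂ _+_ (m<n⇒m/n≡0 (m%n<n (r * D) a)) (m*n/n≡m j a) ⟩
        j                           ∎)) j<k
      where open ≡-Reasoning

    ∈-row : ∀ {r n} → r * D % a ≡ n % a → n / a < kunz r → n ∈ row r
    ∈-row {r} {n} eq n/a<k = subst (_∈ row r)
      (trans (cong (_+ n / a * a) eq) (sym (m≡m%n+[m/n]*n n a)))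
      (∈-applyUpTo⁺ (λ j → r * D % a + j * a) n/a<k)

    ∈-gaps⁻ : ∀ {n} → n ∈ gaps → ∃ λ r → 0 < r × r < a × n ∈ row r
    ∈-gaps⁻ n∈ with ∈-concat⁻′ (applyUpTo (row ∘ suc) q) n∈
    ... | xs , n∈xs , xs∈ with i , i<q , refl ← ∈-applyUpTo⁻ (row ∘ suc) xs∈ =
      suc i , z<s , s<s i<q , n∈xs

    residue≢0 : Coprime a D → ∀ {r} → 0 < r → r < a → r * D % a ≢ 0
    residue≢0 coprime {suc r} _ r<a eq = <⇒≱ r<a (∣⇒≤ (coprime-divisor coprime
      (subst (a ∣_) (*-comm (suc r) D) (m%n≡0⇒n∣m (suc r * D) a eq))))

    -- `residue-eq` at `n = r′ * D` has the shape required by `congruent`, so `r′ = r + j * a`; both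
    -- are below `a`.
    residue-injective : Coprime a D → ∀ {r r′} → r < a → r′ < a →
      r * D % a ≡ r′ * D % a → r ≡ r′
    residue-injective coprime {r} {r′} r<a r′<a eq
      with j , r′≡ ← congruent coprime {r * D / a} {r′} {r′ * D / a} {r} r<a
             (trans (+-comm (r * D / a * a) _) (residue-eq {r′ * D} {r} eq)) = begin
      r                ≡⟨ m<n⇒m%n≡m r<a ⟨
      r % a            ≡⟨ [m+kn]%n≡m%n r j a ⟨
      (r + j * a) % a  ≡⟨ cong (_% a) r′≡ ⟨
      r′ % a           ≡⟨ m<n⇒m%n≡m r′<a ⟩
      r′               ∎
      where open ≡-Reasoning

    gaps-unique : Coprime a D → Unique gaps
    gaps-unique coprime = Unique.concat⁺
      (All.applyUpTo⁺₂ _ q (λ i → Unique.applyUpTo⁺₁ _ (kunz (suc i))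
        (λ i<j _ eq → <⇒≢ i<j (*-cancelʳ-≡ _ _ a (+-cancelˡ-≡ (suc i * D % a) _ _ eq)))))
      (AllPairs.applyUpTo⁺₁ (row ∘ suc) q (λ {i} {j} i<j j<q (n∈i , n∈j) →
        <⇒≢ (s<s i<j) (residue-injective coprime (s<s (<-trans i<j j<q)) (s<s j<q)
          (trans (sym (row-% {suc i} n∈i)) (row-% {suc j} n∈j)))))

    gaps-correct : .{{_ : NonZero k}} → Coprime a D → ∀ n →
      n ∈ gaps ⇔ (0 < n × pos n ∉⟨ generators b a d k ⟩)
    gaps-correct coprime n = mk⇔ to from
      where
      to : n ∈ gaps → 0 < n × pos n ∉⟨ generators b a d k ⟩
      to n∈ with r , 0<r , r<a , n∈row ← ∈-gaps⁻ n∈ =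
          n≢0⇒n>0 (λ { refl → residue≢0 coprime 0<r r<a (sym (row-% {r} n∈row)) })
        , λ n∈A → <⇒≱ (row-/ {r} n∈row)
                    (∈⇒kunz≤ coprime {n} {r} r<a (sym (row-% {r} n∈row)) n∈A)
      from : 0 < n × pos n ∉⟨ generators b a d k ⟩ → n ∈ gaps
      from (_ , n∉) = case coprime-residue coprime n of λ where
        -- As `kunz 0 = 0`, every multiple of `a` is in the semigroup.
        (zero , _ , eq) → contradiction
          (kunz≤⇒∈ {n} {0} eq (subst (_≤ n / a) (sym (trans (+-identityʳ _) (S-zero b k))) z≤n)) n∉
        (suc i , s<s i<q , eq) → ∈-concat⁺′
          (∈-row {suc i} {n} eq (≰⇒> (λ k≤ → n∉ (kunz≤⇒∈ {n} {suc i} eq k≤))))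
          (∈-applyUpTo⁺ (row ∘ suc) i<q)

    -- The number of gaps.

    length-gaps : length gaps ≡
      ∑[ i < q ] S b k (suc (toℕ i)) + ∑[ i < q ] (suc (toℕ i) * D / a)
    length-gaps = begin
      length gaps                        ≡⟨ length-concat-applyUpTo (row ∘ suc) q ⟩
      ∑[ i < q ] length (row (suc (toℕ i))) ≡⟨ sum-cong-≗ (λ (i : Fin q) → length-applyUpTo _ (kunz (suc (toℕ i)))) ⟩
      ∑[ i < q ] kunz (suc (toℕ i))      ≡⟨ ∑-distrib-+ {q} (λ i → S b k (suc (toℕ i))) (λ i → suc (toℕ i) * D / a) ⟩
      ∑[ i < q ] S b k (suc (toℕ i)) + ∑[ i < q ] (suc (toℕ i) * D / a) ∎
      where open ≡-Reasoning

    -- The products add up to `a * D`, and their remainders to more than 0 and less than `a + a`.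
    -- Hence the sum of the floors is below `D` and above `D - 2`.
    floor-pair : Coprime a D → ∀ {r r′} → 0 < r → 0 < r′ → r + r′ ≡ a →
      r * D / a + r′ * D / a ≡ D ∸ 1
    floor-pair coprime {r} {r′} 0<r 0<r′ r+r′≡a =
      cong pred {suc (x + y)} {D} (≤-antisym
        (*-cancelʳ-< a _ _ (begin-strict
          (x + y) * a             <⟨ m<m+n _ (<-≤-trans (n≢0⇒n>0 (residue≢0 coprime 0<r r<a)) (m≤m+n ρ ρ′)) ⟩
          (x + y) * a + (ρ + ρ′)  ≡⟨ total ⟨
          D * a                   ∎))
        (s≤s⁻¹ (*-cancelʳ-< a _ _ (begin-strict
          D * a                   ≡⟨ total ⟩
          (x + y) * a + (ρ + ρ′)  <⟨ +-monoʳ-< ((x + y) * a) (+-mono-< (m%n<n (r * D) a) (m%n<n (r′ * D) a)) ⟩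
          (x + y) * a + (a + a)   ≡⟨ two-more (x + y) a ⟩
          (2 + (x + y)) * a       ∎))))
      where
      open ≤-Reasoning
      x = r * D / a
      y = r′ * D / a
      ρ = r * D % a
      ρ′ = r′ * D % a
      r<a : r < a
      r<a = subst (r <_) r+r′≡a (m<m+n r 0<r′)
      two-more : ∀ z a → z * a + (a + a) ≡ (2 + z) * a
      two-more = solve-∀
      regroup : ∀ ρ x ρ′ y a → (ρ + x * a) + (ρ′ + y * a) ≡ (x + y) * a + (ρ + ρ′)
      regroup = solve-∀
      total : D * a ≡ (x + y) * a + (ρ + ρ′)
      total = begin-equality
        D * a                          ≡⟨ *-comm D a ⟩
        a * D                          ≡⟨ cong (_* D) r+r′≡a ⟨
        (r + r′) * D                   ≡⟨ *-distribʳ-+ D r r′ ⟩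
        r * D + r′ * D                 ≡⟨ cong₂ _+_ (m≡m%n+[m/n]*n (r * D) a) (m≡m%n+[m/n]*n (r′ * D) a) ⟩
        (ρ + x * a) + (ρ′ + y * a)     ≡⟨ regroup ρ x ρ′ y a ⟩
        (x + y) * a + (ρ + ρ′)         ∎

    -- Index `i` stands for `r = suc (toℕ i)`, and `opposite i`, whose value is `q ∸ suc (toℕ i)`,
    -- stands for `a - r`.
    floor-sum : Coprime a D → 2 * ∑[ i < q ] (suc (toℕ i) * D / a) ≡ q * (D ∸ 1)
    floor-sum coprime = 2*∑ (λ i → suc (toℕ i) * D / a) (λ i →
      floor-pair coprime z<s z<s (trans (cong (λ j → suc (toℕ i) + suc j) (opposite-prop i))
        (trans (+-suc (suc (toℕ i)) _) (cong suc (m+[n∸m]≡n (toℕ<n i))))))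

    -- The Frobenius number.

    -- The largest element of the Apéry set of a is the one of residue (a ∸ 1) * D.
    top : ℕ
    top = S b k q * a + q * D

    -- If `n = s * a + m * D` with `S b k m ≤ s`, then `top = suc s * a + m * D`, and `apery` at
    -- `r = q` gives `suc s ≤ S b k m`. The form `n + a ≡ top` avoids a difference that can be
    -- negative.
    top-a∉ : Coprime a D → ∀ {n} → n + a ≡ top → pos n ∉⟨ generators b a d k ⟩
    top-a∉ coprime n+a≡top n∈ =
      let s , m , S≤s , n≡ = ∈⇒value n∈ in
      <⇒≱ (n<1+n s) (+-cancelˡ-≤ (S b k q) _ _ (≤-trans
        (apery coprime {suc s} {m} {S b k q} {q} ≤-refl
          (trans (regroup s a (m * D)) (trans (cong (_+ a) (sym n≡)) n+a≡top)))
        (+-monoʳ-≤ (S b k q) S≤s)))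
      where
      regroup : ∀ s a y → suc s * a + y ≡ s * a + y + a
      regroup = solve-∀

    -- By `apery-mono`, `top` bounds all Apéry elements, so `n` is strictly above the one in its
    -- class.
    above-top⇒kunz< : ∀ {n r} → r < a → r * D % a ≡ n % a → top < n → kunz r < n / a
    above-top⇒kunz< {n} {r} r<a eq top<n = *-cancelʳ-< a _ _ (+-cancelʳ-< (r * D) _ _ (begin-strict
      kunz r * a + r * D                    ≡⟨ regroup (S b k r) _ a _ ⟩
      S b k r * a + r * D + r * D / a * a   ≤⟨ +-monoˡ-≤ _ (apery-mono (s≤s⁻¹ r<a)) ⟩
      top + r * D / a * a                   <⟨ +-monoˡ-< _ top<n ⟩
      n + r * D / a * a                     ≡⟨ residue-eq {n} {r} eq ⟩
      n / a * a + r * D                     ∎))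
      where
      open ≤-Reasoning
      regroup : ∀ s x a y → (s + x) * a + y ≡ s * a + y + x * a
      regroup = solve-∀

    -- `n` lies `suc e` copies of `a` above the Apéry element of its class, so one copy can be given
    -- up.
    above-top : .{{_ : NonZero k}} → Coprime a D → ∀ {n} → top < n →
      ∃ λ m → n ≡ m + a × pos m ∈⟨ generators b a d k ⟩
    above-top coprime {n} top<n =
      let r , r<a , eq = coprime-residue coprime n
          e , k+e≡ = m≤n⇒∃[o]m+o≡n (above-top⇒kunz< {n} {r} r<a eq top<n)
      in
        (S b k r + e) * a + r * D
      , trans (kunz+⇒value {n} {r} (suc e) eq (sym (trans (+-suc _ e) k+e≡))) (regroup (S b k r) e a _)
      , value⇒∈ {S b k r + e} {r} (m≤m+n (S b k r) e)
      where
      regroup : ∀ s e a y → (s + suc e) * a + y ≡ (s + e) * a + y + a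
      regroup = solve-∀

open AperySet
open import Data.Integer.Base as ℤ using (+<+)
import Data.Integer.Properties as ℤ
import Data.Integer.Tactic.RingSolver as ℤ
import Data.Nat.Base as ℕ
import Data.List.Base as List
import Data.Nat.DivMod as ℕ
import Data.Nat.Properties as ℕ
import Data.Rational.Properties as ℚ
import Data.Rational.Unnormalised.Base as ℚᵘ
import Data.Rational.Unnormalised.Properties as ℚᵘ
open import Data.Nat.Coprimality using (Coprime; gcd≡1⇒coprime)
open import Data.Product.Base using (_,_)
open import Relation.Binary.PropositionalEquality using (refl; sym; trans; cong; cong₂; subst; module ≡-Reasoning)
open import Relation.Nullary.Decidable.Core using (decidable-stable)

open import Data.Fin.Base using (toℕ)
open import Data.Integer.Base using (+_; _+_; _-_; _*_)
open import Data.Nat.Base using (ℕ; suc; _∸_; _≤_; NonZero; NonTrivial)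
open import Data.Nat.GCD using (gcd)
open import Data.Nat.Properties using (+-*-semiring)
open import Algebra.Properties.Semiring.Sum +-*-semiring using (sum-syntax)
open import Data.Product.Base using (∃; _×_)
open import Data.Rational.Base as ℚ using (_/_)
open import Relation.Binary.PropositionalEquality using (_≡_)

-- Passage to the integer and rational formulas.

pos-pred : ∀ n .{{_ : NonZero n}} → + n - + 1 ≡ + (n ∸ 1)
pos-pred (suc n) = refl

-- Fractions in `ℚ` are kept in lowest terms, so the identity is checked by cross-multiplying
-- unnormalised ones.
integer+half : ∀ m n → + m / 1 ℚ.+ + (2 ℕ.* n) / 2 ≡ + (m ℕ.+ n) / 1
integer+half m n = ℚ.toℚᵘ-injective (begin
  ℚ.toℚᵘ (+ m / 1 ℚ.+ + (2 ℕ.* n) / 2)                  ≈⟨ ℚ.toℚᵘ-homo-+ (+ m / 1) (+ (2 ℕ.* n) / 2) ⟩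
  ℚ.toℚᵘ (+ m / 1) ℚᵘ.+ ℚ.toℚᵘ (+ (2 ℕ.* n) / 2)        ≈⟨ ℚᵘ.+-cong (ℚ.toℚᵘ-fromℚᵘ (ℚᵘ.mkℚᵘ (+ m) 0)) (ℚ.toℚᵘ-fromℚᵘ (ℚᵘ.mkℚᵘ (+ (2 ℕ.* n)) 1)) ⟩
  ℚᵘ.mkℚᵘ (+ m) 0 ℚᵘ.+ ℚᵘ.mkℚᵘ (+ (2 ℕ.* n)) 1          ≈⟨ ℚᵘ.*≡* cross ⟩
  ℚᵘ.mkℚᵘ (+ (m ℕ.+ n)) 0                               ≈⟨ ℚ.toℚᵘ-fromℚᵘ (ℚᵘ.mkℚᵘ (+ (m ℕ.+ n)) 0) ⟨
  ℚ.toℚᵘ (+ (m ℕ.+ n) / 1)                              ∎)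
  where
  open ℚᵘ.≃-Reasoning
  expand : ∀ x y → (x * + 2 + (+ 2 * y) * + 1) * + 1 ≡ (x + y) * + 2
  expand = ℤ.solve-∀
  cross : (+ m * + 2 + + (2 ℕ.* n) * + 1) * + 1 ≡ + (m ℕ.+ n) * + 2
  cross = trans (cong (λ z → (+ m * + 2 + z * + 1) * + 1) (ℤ.pos-* 2 n)) (expand (+ m) (+ n))

module _ (q d b k : ℕ) .{{_ : NonZero d}} .{{_ : NonTrivial b}} where
  private
    instance _ = ℕ.nonTrivial⇒nonZero b
    a D : ℕ
    a = suc q
    D = (b ∸ 1) ℕ.* a ℕ.+ d

  -- Since `b * a + d = a + D`, the left side is `S b k q * a + D * a - D - a`, and
  -- `D * a - D = q * D`.
  frobenius≡ :
    ((+ b - + 1) * + a - + b + + d + + S b k q) * + a - + d ≡ + top q d b k - + a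
  frobenius≡ = begin
    ((+ b - + 1) * + a - + b + + d + s) * + a - + d
      ≡⟨ cong (λ x → (x * + a - + b + + d + s) * + a - + d) (pos-pred b) ⟩
    (p * + a - + b + + d + s) * + a - + d
      ≡⟨ cong (λ x → (p * + a - x + + d + s) * + a - + d) b≡ ⟩
    (p * + a - (+ 1 + p) + + d + s) * + a - + d
      ≡⟨ rearrange p (+ q) (+ d) s ⟩
    s * + a + + q * (p * + a + + d) - + a
      ≡⟨ cong (_- + a) top≡ ⟨
    + top q d b k - + a ∎
    where
    open ≡-Reasoning
    p = + (b ∸ 1)
    s = + S b k q
    b≡ : + b ≡ + 1 + p
    b≡ = cong +_ (sym (ℕ.suc-pred b))
    rearrange : ∀ p q d s →
      (p * (+ 1 + q) - (+ 1 + p) + d + s) * (+ 1 + q) - d ≡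
      s * (+ 1 + q) + q * (p * (+ 1 + q) + d) - (+ 1 + q)
    rearrange = ℤ.solve-∀
    top≡ : + top q d b k ≡ s * + a + + q * (p * + a + + d)
    top≡ = cong₂ _+_ (ℤ.pos-* (S b k q) a)
      (trans (ℤ.pos-* q D) (cong (λ x → + q * (x + + d)) (ℤ.pos-* (b ∸ 1) a)))

  isFrobenius : .{{_ : NonZero k}} → Coprime a D →
    IsFrobenius (generators b a d k) (+ top q d b k - + a)
  isFrobenius coprime = ∉ , largest
    where
    w = + top q d b k
    cancel : ∀ x y → x - y + y ≡ x
    cancel = ℤ.solve-∀
    cancel′ : ∀ x y → x + y - y ≡ x
    cancel′ = ℤ.solve-∀
    ∉ : (w - + a) ∉⟨ generators b a d k ⟩
    ∉ (c , f≡) = top-a∉ q d b k coprime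
      (ℤ.+-injective (trans (cong (_+ + a) (sym f≡)) (cancel w (+ a))))
      (c , refl)
    shift : ∀ z m → z + + a ≡ + (m ℕ.+ a) → z ≡ + m
    shift z m eq = trans (sym (cancel′ z (+ a))) (trans (cong (_- + a) eq) (cancel′ (+ m) (+ a)))
    above∈ : ∀ z x → z + + a ≡ x → w ℤ.< x → z ∈⟨ generators b a d k ⟩
    -- `w` is nonnegative, so `w < x` leaves only a nonnegative `x`; no case split on the sign of
    -- `z` arises.
    above∈ z (+ n) z+a≡n (+<+ w<n) =
      let m , n≡m+a , m∈ = above-top q d b k coprime w<n in
      subst (_∈⟨ generators b a d k ⟩) (sym (shift z m (trans z+a≡n (cong +_ n≡m+a)))) m∈
    largest : ∀ z → z ∉⟨ generators b a d k ⟩ → z ℤ.≤ w - + a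
    -- The order on `ℤ` is decidable, so it suffices to refute `z > w - a`, that is, `z + a > w`.
    largest z z∉ = decidable-stable (z ℤ.≤? w - + a) (λ z≰ → z∉ (above∈ z (z + + a) refl
      (subst (ℤ._< z + + a) (cancel w (+ a)) (ℤ.+-monoˡ-< (+ a) (ℤ.≰⇒> z≰)))))

  -- `floor-sum` gives twice the sum of the floors, whence the fraction with denominator 2.
  genus≡ : Coprime a D →
    + List.length (gaps q d b k) / 1 ≡
      + (∑[ i < q ] S b k (suc (toℕ i))) / 1
      ℚ.+ ((+ a - + 1) * ((+ b - + 1) * + a + + d - + 1)) / 2
  genus≡ coprime = begin
    + List.length (gaps q d b k) / 1    ≡⟨ cong (λ n → + n / 1) (length-gaps q d b k) ⟩
    + (∑S ℕ.+ ∑⌊⌋) / 1                  ≡⟨ integer+half ∑S ∑⌊⌋ ⟨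
    + ∑S / 1 ℚ.+ + (2 ℕ.* ∑⌊⌋) / 2      ≡⟨ cong (λ z → + ∑S / 1 ℚ.+ z / 2) twice ⟩
    + ∑S / 1 ℚ.+ (+ q * ((+ b - + 1) * + a + + d - + 1)) / 2 ∎
    where
    open ≡-Reasoning
    ∑S ∑⌊⌋ : ℕ
    ∑S = ∑[ i < q ] S b k (suc (toℕ i))
    ∑⌊⌋ = ∑[ i < q ] (suc (toℕ i) ℕ.* D ℕ./ a)
    instance
      -- `D ≥ d > 0`, so `D ∸ 1` is a true subtraction.
      D≢0 : NonZero D
      D≢0 = ℕ.>-nonZero (ℕ.<-≤-trans (ℕ.>-nonZero⁻¹ d) (ℕ.m≤n+m d _))
    twice : + (2 ℕ.* ∑⌊⌋) ≡ + q * ((+ b - + 1) * + a + + d - + 1)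
    twice = begin
      + (2 ℕ.* ∑⌊⌋)                               ≡⟨ cong +_ (floor-sum q d b k coprime) ⟩
      + (q ℕ.* (D ∸ 1))                           ≡⟨ ℤ.pos-* q (D ∸ 1) ⟩
      + q * + (D ∸ 1)                             ≡⟨ cong (+ q *_) (pos-pred D) ⟨
      + q * (+ D - + 1)                           ≡⟨ cong (λ x → + q * (x + + d - + 1)) (ℤ.pos-* (b ∸ 1) a) ⟩
      + q * (+ (b ∸ 1) * + a + + d - + 1)         ≡⟨ cong (λ x → + q * (x * + a + + d - + 1)) (pos-pred b) ⟨
      + q * ((+ b - + 1) * + a + + d - + 1)       ∎

theorem3p5 :
    (a d b k : ℕ)
    .{{_ : NonZero a}} .{{_ : NonZero d}} .{{_ : NonTrivial b}} .{{_ : NonZero k}} →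
    gcd a d ≡ 1 →
    k ∸ 1 ≤ a →
    IsFrobenius (generators b a d k)
      (((+ b - + 1) * + a - + b + + d + + S b k (a ∸ 1)) * + a - + d)
    ×
    (∃ λ g → IsGenus (generators b a d k) g ×
      + g / 1 ≡
        + (∑[ i < a ∸ 1 ] S b k (suc (toℕ i))) / 1
        ℚ.+ ((+ a - + 1) * ((+ b - + 1) * + a + + d - + 1)) / 2)
theorem3p5 (suc q) d b k gcd≡1 _ =
    subst (IsFrobenius (generators b (suc q) d k)) (sym (frobenius≡ q d b k))
      (isFrobenius q d b k coprime)
  , List.length (gaps q d b k)
  , (gaps q d b k , gaps-unique q d b k coprime , gaps-correct q d b k coprime , refl)
  , genus≡ q d b k coprime
  where
  coprime : Coprime (suc q) ((b ∸ 1) ℕ.* suc q ℕ.+ d)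
  coprime = coprime-D q d b k (gcd≡1⇒coprime gcd≡1)
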